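{- Let $\Sigma$ be a one-sorted signature. A cell $\langle s,u,v,t\rangle$ (with $s\colon o_1\to o_0$, $u\colon o_2\to o_0$, $v\colon o_3\to o_1$, $t\colon o_3\to o_2$ arrows of $\mathbf{Th}[\Sigma]$) is generated by the pullback basis $\mathcal{B}(\Sigma)$ if and only if $(o_3,v,t)$ is a pullback of $s$ and $u$ in $\mathbf{Th}[\Sigma]$. That is, $\mathcal{B}(\Sigma)$ generates all and only the pullback squares of $\mathbf{Th}[\Sigma]$.
   Context: $\mathbf{Th}[\Sigma]$ is the free algebraic (Lawvere) theory of $\Sigma$: objects are natural numbers $\underline{n}$; an arrow $\underline{n}\to\underline{m}$ is an $m$-tuple of $\Sigma$-terms over $x_1,\dots,x_n$ (equivalently a substitution); composition $\alpha;\beta$ (diagrammatic, $\alpha$ first) is substitution; $\otimes$ is juxtaposition on disjoint variable blocks. An $n$-ary $f\in\Sigma$ is the arrow $f\colon\underline{n}\to\underline{1}$. Symmetry $\gamma_{\underline{n},\underline{m}}=\langle x_{n+1},\dots,x_{n+m},x_1,\dots,x_n\rangle$; duplicator $\nabla_{\underline{n}}=\langle x_1,\dots,x_n,x_1,\dots,x_n\rangle\colon\underline{n}\to\underline{2n}$. A pullback of $s\colon o_1\to o_0$ and $u\colon o_2\to o_0$ is an object $o_3$ with $v\colon o_3\to o_1$, $t\colon o_3\to o_2$, $t;u=v;s$, such that every other such pair factors uniquely through $(v,t)$. A cell is a quadruple $\langle s,u,v,t\rangle$ of arrows with the typing above and $t;u=v;s$. Identity cells: $\langle h,id,id,h\rangle$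 and $\langle id,v,v,id\rangle$. Horizontal composition of $A=\langle s_1,u_1,v_1,t_1\rangle$, $B=\langle s_2,u_2,v_2,t_2\rangle$ with $v_1=u_2$: $A*B=\langle s_2;s_1,u_1,v_2,t_2;t_1\rangle$; vertical composition when $t_1=s_2$: $A\cdot B=\langle s_1,u_2;u_1,v_2;v_1,t_2\rangle$; parallel composition $\otimes$ componentwise. The pullback basis $\mathcal{B}(\Sigma)$ consists of, for each $n$-ary $f\in\Sigma$: $R_f=\langle f,f,id_{\underline{n}},id_{\underline{n}}\rangle$, $D_f=\langle f\otimes id_{\underline{1}},\nabla_{\underline{1}},\nabla_{\underline{n}};(id_{\underline{n}}\otimes f),f\rangle$, $\hat D_f=\langle\nabla_{\underline{1}},f\otimes id_{\underline{1}},f,\nabla_{\underline{n}};(id_{\underline{n}}\otimes f)\rangle$; and $R_\nabla=\langle\nabla_{\underline{1}},\nabla_{\underline{1}},id_{\underline{1}},id_{\underline{1}}\rangle$, $R_\gamma=\langle\gamma_{\underline{1},\underline{1}},\gamma_{\underline{1},\underline{1}},id_{\underline{2}},id_{\underline{2}}\rangle$, $D_\nabla=\langle\nabla_{\underline{1}}\otimes id_{\underline{1}},id_{\underline{1}}\otimes\nabla_{\underline{1}},\nabla_{\underline{1}},\nabla_{\underline{1}}\rangle$. A cell is generated by $\mathcal{B}(\Sigma)$ if obtained from cells of $\mathcal{B}(\Sigma)$ and identity cells by finitely many horizontal, vertical and parallel compositions. -}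

module Defs where

open import Data.Nat using (ℕ; _+_)
open import Data.Fin using (Fin; _↑ˡ_; _↑ʳ_)
open import Data.Vec using (Vec; []; _∷_; lookup; tabulate; _++_)
open import Data.Product using (_×_; ∃!)
open import Relation.Binary.PropositionalEquality using (_≡_)

record Signature : Set₁ where
  field
    Sym : Set
    ar  : Sym → ℕ
open Signature public

data Term (S : Signature) (n : ℕ) : Set where
  var : Fin n → Term S n
  op  : (f : Sym S) → Vec (Term S n) (ar S f) → Term S n

-- An arrow n → m of Th[Σ]: an m-tuple of terms over n variables.
Arr : Signature → ℕ → ℕ → Set
Arr S n m = Vec (Term S n) m

module _ {S : Signature} where

  mutual
    sub : ∀ {n m} → Vec (Term S m) n → Term S n → Term S m
    sub σ (var i)   = lookup σ i
    sub σ (op f ts) = op f (subs σ ts)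

    subs : ∀ {n m k} → Vec (Term S m) n → Vec (Term S n) k → Vec (Term S m) k
    subs σ []       = []
    subs σ (t ∷ ts) = sub σ t ∷ subs σ ts

  -- diagrammatic composition α ; β (α first) is substitution of α into β
  infixl 5 _⨾_
  _⨾_ : ∀ {n m k} → Arr S n m → Arr S m k → Arr S n k
  α ⨾ β = subs α β

  idA : (n : ℕ) → Arr S n n
  idA n = tabulate var

  infixr 6 _⊗_
  _⊗_ : ∀ {n m n' m'} → Arr S n m → Arr S n' m' → Arr S (n + n') (m + m')
  _⊗_ {n} {m} {n'} α β =
    subs (tabulate (λ i → var (i ↑ˡ n'))) α
      ++ subs (tabulate (λ i → var (n ↑ʳ i))) β

  ∇ : (n : ℕ) → Arr S n (n + n)
  ∇ n = idA n ++ idA n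

  γ : (n m : ℕ) → Arr S (n + m) (m + n)
  γ n m = tabulate (λ i → var (n ↑ʳ i)) ++ tabulate (λ i → var (i ↑ˡ m))

  sym : (f : Sym S) → Arr S (ar S f) 1
  sym f = op f (idA (ar S f)) ∷ []

  IsPullback : ∀ {o₀ o₁ o₂ o₃} → Arr S o₁ o₀ → Arr S o₂ o₀ → Arr S o₃ o₁ → Arr S o₃ o₂ → Set
  IsPullback {o₀} {o₁} {o₂} {o₃} s u v t =
    (t ⨾ u ≡ v ⨾ s) ×
    (∀ {o} (v' : Arr S o o₁) (t' : Arr S o o₂) → t' ⨾ u ≡ v' ⨾ s →
       ∃! _≡_ (λ (h : Arr S o o₃) → (h ⨾ v ≡ v') × (h ⨾ t ≡ t')))

-- Cells generated by the pullback basis B(Σ) under identity cells and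
-- horizontal, vertical and parallel composition.  Gen s u v t : ⟨s,u,v,t⟩ is generated.
data Gen {S : Signature} : ∀ {o₀ o₁ o₂ o₃} →
         Arr S o₁ o₀ → Arr S o₂ o₀ → Arr S o₃ o₁ → Arr S o₃ o₂ → Set where
  R-f   : (f : Sym S) → Gen (sym f) (sym f) (idA (ar S f)) (idA (ar S f))
  D-f   : (f : Sym S) →
          Gen (sym f ⊗ idA 1) (∇ 1) (∇ (ar S f) ⨾ (idA (ar S f) ⊗ sym f)) (sym f)
  D̂-f   : (f : Sym S) →
          Gen (∇ 1) (sym f ⊗ idA 1) (sym f) (∇ (ar S f) ⨾ (idA (ar S f) ⊗ sym f))
  R-∇   : Gen (∇ 1) (∇ 1) (idA 1) (idA 1)
  R-γ   : Gen (γ 1 1) (γ 1 1) (idA 2) (idA 2)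
  D-∇   : Gen (∇ 1 ⊗ idA 1) (idA 1 ⊗ ∇ 1) (∇ 1) (∇ 1)
  idH   : ∀ {o₀ o₁} (h : Arr S o₁ o₀) → Gen h (idA o₀) (idA o₁) h
  idV   : ∀ {o₀ o₂} (w : Arr S o₂ o₀) → Gen (idA o₀) w w (idA o₂)
  hor   : ∀ {o₀ o₁ o₂ o₃ o₁' o₃'}
          {s₁ : Arr S o₁ o₀} {u₁ : Arr S o₂ o₀} {v₁ : Arr S o₃ o₁} {t₁ : Arr S o₃ o₂}
          {s₂ : Arr S o₁' o₁} {v₂ : Arr S o₃' o₁'} {t₂ : Arr S o₃' o₃} →
          Gen s₁ u₁ v₁ t₁ → Gen s₂ v₁ v₂ t₂ → Gen (s₂ ⨾ s₁) u₁ v₂ (t₂ ⨾ t₁)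
  ver   : ∀ {o₀ o₁ o₂ o₃ o₂' o₃'}
          {s₁ : Arr S o₁ o₀} {u₁ : Arr S o₂ o₀} {v₁ : Arr S o₃ o₁} {t₁ : Arr S o₃ o₂}
          {u₂ : Arr S o₂' o₂} {v₂ : Arr S o₃' o₃} {t₂ : Arr S o₃' o₂'} →
          Gen s₁ u₁ v₁ t₁ → Gen t₁ u₂ v₂ t₂ → Gen s₁ (u₂ ⨾ u₁) (v₂ ⨾ v₁) t₂
  par   : ∀ {o₀ o₁ o₂ o₃ p₀ p₁ p₂ p₃}
          {s₁ : Arr S o₁ o₀} {u₁ : Arr S o₂ o₀} {v₁ : Arr S o₃ o₁} {t₁ : Arr S o₃ o₂}
          {s₂ : Arr S p₁ p₀} {u₂ : Arr S p₂ p₀} {v₂ : Arr S p₃ p₁} {t₂ : Arr S p₃ p₂} →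
          Gen s₁ u₁ v₁ t₁ → Gen s₂ u₂ v₂ t₂ →
          Gen (s₁ ⊗ s₂) (u₁ ⊗ u₂) (v₁ ⊗ v₂) (t₁ ⊗ t₂)

{-# OPTIONS --safe #-}

-- Pullback squares contain the basis and the identity cells and are closed under pasting and ⊗, so
-- every generated cell is a pullback.  Conversely, isomorphisms of Th[Σ] are variable permutations,
-- whose cells are generated from R-γ; as pullbacks are unique up to isomorphism, it suffices to
-- generate some cell over every cospan (s , u) that admits a commutative square.  Decomposing s into
-- permutations, dischargers, duplicators and operation symbols reduces this to s = ∇ 1, where u is a
-- pair of terms to be unified.  Tensoring with identities in the decomposition requires pulling
-- ∇ n back along e ⊗ id for arbitrary e, i.e. D-f for all arrows.
module Submission where

open import Defs
open import Data.Nat using (ℕ; zero; suc; _+_)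
open import Data.Fin using (Fin; zero; suc; _↑ˡ_; _↑ʳ_; punchIn; punchOut)
open import Data.Fin.Properties using (_≟_; punchIn-punchOut)
open import Data.Fin.Permutation using (Permutation; permutation; _⟨$⟩ʳ_; _⟨$⟩ˡ_; remove; punchIn-permute)
open import Data.Vec using (Vec; []; _∷_; lookup; tabulate; _++_)
open import Data.Vec.Properties using (++-injective; tabulate∘lookup; lookup∘tabulate; tabulate-cong; lookup-++ˡ; lookup-++ʳ)
open import Data.Product using (_×_; _,_; proj₁; proj₂; ∃-syntax; ∃!)
open import Function using (_∘_; id; case_of_)
open import Function.Bundles using (_⇔_; mk⇔)
open import Relation.Nullary using (yes; no)
open import Relation.Binary.PropositionalEquality using (_≡_; refl; trans; cong; cong₂; subst; module ≡-Reasoning) renaming (sym to ≡-sym)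

module _ {S : Signature} where

  -- The cartesian structure of Th[Σ]

  ren : ∀ {m n} → (Fin n → Fin m) → Arr S m n
  ren p = tabulate (var ∘ p)

  fst : (n m : ℕ) → Arr S (n + m) n
  fst n m = ren (_↑ˡ m)

  snd : (n m : ℕ) → Arr S (n + m) m
  snd n m = ren (n ↑ʳ_)

  lookup-⨾ : ∀ {n m k} (σ : Arr S m n) (α : Arr S n k) i → lookup (σ ⨾ α) i ≡ sub σ (lookup α i)
  lookup-⨾ σ (t ∷ α) zero    = refl
  lookup-⨾ σ (t ∷ α) (suc i) = lookup-⨾ σ α i

  ⨾-tabulate : ∀ {n m k} (σ : Arr S m n) (g : Fin k → Term S n) →
               σ ⨾ tabulate g ≡ tabulate (sub σ ∘ g)
  ⨾-tabulate {k = zero}  σ g = refl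
  ⨾-tabulate {k = suc k} σ g = cong (sub σ (g zero) ∷_) (⨾-tabulate σ (g ∘ suc))

  ren-⨾ : ∀ {k m n} (p : Fin m → Fin k) (q : Fin n → Fin m) → ren p ⨾ ren q ≡ ren (p ∘ q)
  ren-⨾ p q = trans (⨾-tabulate (ren p) (var ∘ q)) (tabulate-cong (lookup∘tabulate (var ∘ p) ∘ q))

  mutual
    sub-id : ∀ {n} (t : Term S n) → sub (idA n) t ≡ t
    sub-id (var i)   = lookup∘tabulate var i
    sub-id (op f ts) = cong (op f) (⨾-identityˡ ts)

    ⨾-identityˡ : ∀ {n k} (α : Arr S n k) → idA n ⨾ α ≡ α
    ⨾-identityˡ []      = refl
    ⨾-identityˡ (t ∷ α) = cong₂ _∷_ (sub-id t) (⨾-identityˡ α)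

  ⨾-identityʳ : ∀ {n k} (α : Arr S n k) → α ⨾ idA k ≡ α
  ⨾-identityʳ α = trans (⨾-tabulate α var) (tabulate∘lookup α)

  mutual
    sub-⨾ : ∀ {n m k} (σ : Arr S n m) (τ : Arr S m k) t → sub (σ ⨾ τ) t ≡ sub σ (sub τ t)
    sub-⨾ σ τ (var i)   = lookup-⨾ σ τ i
    sub-⨾ σ τ (op f ts) = cong (op f) (⨾-assoc σ τ ts)

    ⨾-assoc : ∀ {n m k l} (σ : Arr S n m) (τ : Arr S m k) (ρ : Arr S k l) →
              (σ ⨾ τ) ⨾ ρ ≡ σ ⨾ (τ ⨾ ρ)
    ⨾-assoc σ τ []      = refl
    ⨾-assoc σ τ (t ∷ ρ) = cong₂ _∷_ (sub-⨾ σ τ t) (⨾-assoc σ τ ρ)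

  ⨾-++ : ∀ {n m k l} (σ : Arr S n m) (α : Arr S m k) (β : Arr S m l) →
         σ ⨾ (α ++ β) ≡ (σ ⨾ α) ++ (σ ⨾ β)
  ⨾-++ σ []      β = refl
  ⨾-++ σ (t ∷ α) β = cong (_ ∷_) (⨾-++ σ α β)

  ++-fst : ∀ {o n m} (α : Arr S o n) (β : Arr S o m) → (α ++ β) ⨾ fst n m ≡ α
  ++-fst α β = trans (⨾-tabulate (α ++ β) _)
              (trans (tabulate-cong (lookup-++ˡ α β)) (tabulate∘lookup α))

  ++-snd : ∀ {o n m} (α : Arr S o n) (β : Arr S o m) → (α ++ β) ⨾ snd n m ≡ β
  ++-snd α β = trans (⨾-tabulate (α ++ β) _)
              (trans (tabulate-cong (lookup-++ʳ α β)) (tabulate∘lookup β))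

  fst++snd : ∀ n m → fst n m ++ snd n m ≡ idA (n + m)
  fst++snd zero    m = refl
  fst++snd (suc n) m = cong (var zero ∷_)
    (trans (cong₂ _++_ (≡-sym (ren-⨾ suc (_↑ˡ m))) (≡-sym (ren-⨾ suc (n ↑ʳ_))))
    (trans (≡-sym (⨾-++ (ren suc) (fst n m) (snd n m)))
    (trans (cong (ren suc ⨾_) (fst++snd n m)) (ren-⨾ suc id))))

  ++-η : ∀ {o} n {m} (α : Arr S o (n + m)) → (α ⨾ fst n m) ++ (α ⨾ snd n m) ≡ α
  ++-η n {m} α = trans (≡-sym (⨾-++ α (fst n m) (snd n m)))
                (trans (cong (α ⨾_) (fst++snd n m)) (⨾-identityʳ α))

  ++-⊗ : ∀ {o n m n' m'} (x : Arr S o n) (y : Arr S o n') (α : Arr S n m) (β : Arr S n' m') →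
         (x ++ y) ⨾ (α ⊗ β) ≡ (x ⨾ α) ++ (y ⨾ β)
  ++-⊗ {n = n} {n' = n'} x y α β =
    trans (⨾-++ (x ++ y) (fst n n' ⨾ α) (snd n n' ⨾ β))
    (cong₂ _++_
      (trans (≡-sym (⨾-assoc (x ++ y) (fst n n') α)) (cong (_⨾ α) (++-fst x y)))
      (trans (≡-sym (⨾-assoc (x ++ y) (snd n n') β)) (cong (_⨾ β) (++-snd x y))))

  ⊗-⨾ : ∀ {n m k n' m' k'} (α : Arr S n m) (β : Arr S m k) (α' : Arr S n' m') (β' : Arr S m' k') →
        (α ⊗ α') ⨾ (β ⊗ β') ≡ (α ⨾ β) ⊗ (α' ⨾ β')
  ⊗-⨾ {n} {n' = n'} α β α' β' =
    trans (++-⊗ (fst n n' ⨾ α) (snd n n' ⨾ α') β β')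
          (cong₂ _++_ (⨾-assoc (fst n n') α β) (⨾-assoc (snd n n') α' β'))

  id⊗id : ∀ n m → idA n ⊗ idA m ≡ idA {S} (n + m)
  id⊗id n m = trans (cong₂ _++_ (⨾-identityʳ (fst n m)) (⨾-identityʳ (snd n m))) (fst++snd n m)

  ∇-⊗ : ∀ {n k l} (α : Arr S n k) (β : Arr S n l) → ∇ n ⨾ (α ⊗ β) ≡ α ++ β
  ∇-⊗ α β = trans (++-⊗ (idA _) (idA _) α β) (cong₂ _++_ (⨾-identityˡ α) (⨾-identityˡ β))

  ⨾-∇ : ∀ {n k} (α : Arr S n k) → α ⨾ ∇ k ≡ α ++ α
  ⨾-∇ α = trans (⨾-++ α (idA _) (idA _)) (cong₂ _++_ (⨾-identityʳ α) (⨾-identityʳ α))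

  ++-γ : ∀ {o n m} (x : Arr S o n) (y : Arr S o m) → (x ++ y) ⨾ γ n m ≡ y ++ x
  ++-γ {n = n} {m} x y = trans (⨾-++ (x ++ y) (snd n m) (fst n m)) (cong₂ _++_ (++-snd x y) (++-fst x y))

  ⊗-split : ∀ {n m n' m'} (α : Arr S n m) (β : Arr S n' m') → (α ⊗ idA n') ⨾ (idA m ⊗ β) ≡ α ⊗ β
  ⊗-split α β = trans (⊗-⨾ α (idA _) (idA _) β) (cong₂ _⊗_ (⨾-identityʳ α) (⨾-identityˡ β))

  -- The generic pair `fst n m ++ snd n m` is the identity, so testing on it alone decides equality.
  -- Coherence equations thereby become computations with tuples.
  ++-ext : ∀ {n m k} {α β : Arr S (n + m) k} →
           (∀ {o} (x : Arr S o n) (y : Arr S o m) → (x ++ y) ⨾ α ≡ (x ++ y) ⨾ β) → α ≡ β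
  ++-ext {n} {m} {α = α} {β} h =
    trans (≡-sym (id-pair α)) (trans (h (fst n m) (snd n m)) (id-pair β))
    where
    id-pair : ∀ {k} (α : Arr S (n + m) k) → (fst n m ++ snd n m) ⨾ α ≡ α
    id-pair α = trans (cong (_⨾ α) (fst++snd n m)) (⨾-identityˡ α)

  ++-ext₄ : ∀ {a b c d k} {α β : Arr S ((a + b) + (c + d)) k} →
            (∀ {o} (x : Arr S o a) (y : Arr S o b) (z : Arr S o c) (w : Arr S o d) →
               ((x ++ y) ++ (z ++ w)) ⨾ α ≡ ((x ++ y) ++ (z ++ w)) ⨾ β) → α ≡ β
  ++-ext₄ {a} {b} {c} {d} {α = α} {β} h = ++-ext λ x y →
    subst (λ σ → σ ⨾ α ≡ σ ⨾ β) (cong₂ _++_ (++-η a x) (++-η c y)) 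
      (h (x ⨾ fst a b) (x ⨾ snd a b) (y ⨾ fst c d) (y ⨾ snd c d))

  -- The middle-four interchange of variable blocks.
  μ : (a b c d : ℕ) → Arr S ((a + b) + (c + d)) ((a + c) + (b + d))
  μ a b c d = (fst a b ⊗ fst c d) ++ (snd a b ⊗ snd c d)

  ++-μ : ∀ {o a b c d} (x : Arr S o a) (y : Arr S o b) (z : Arr S o c) (w : Arr S o d) →
         ((x ++ y) ++ (z ++ w)) ⨾ μ a b c d ≡ (x ++ z) ++ (y ++ w)
  ++-μ {a = a} {b} {c} {d} x y z w =
    trans (⨾-++ ((x ++ y) ++ (z ++ w)) (fst a b ⊗ fst c d) (snd a b ⊗ snd c d))
    (cong₂ _++_
      (trans (++-⊗ (x ++ y) (z ++ w) (fst a b) (fst c d)) (cong₂ _++_ (++-fst x y) (++-fst z w)))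
      (trans (++-⊗ (x ++ y) (z ++ w) (snd a b) (snd c d)) (cong₂ _++_ (++-snd x y) (++-snd z w))))

  ∇-+ : ∀ n m → (∇ n ⊗ ∇ m) ⨾ μ n n m m ≡ ∇ {S} (n + m)
  ∇-+ n m = ++-ext λ x y → begin
    (x ++ y) ⨾ ((∇ n ⊗ ∇ m) ⨾ μ n n m m)    ≡⟨ ⨾-assoc (x ++ y) (∇ n ⊗ ∇ m) (μ n n m m) ⟨
    (x ++ y) ⨾ (∇ n ⊗ ∇ m) ⨾ μ n n m m      ≡⟨ cong (_⨾ μ n n m m) (++-⊗ x y (∇ n) (∇ m)) ⟩
    ((x ⨾ ∇ n) ++ (y ⨾ ∇ m)) ⨾ μ n n m m    ≡⟨ cong (_⨾ μ n n m m) (cong₂ _++_ (⨾-∇ x) (⨾-∇ y)) ⟩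
    ((x ++ x) ++ (y ++ y)) ⨾ μ n n m m      ≡⟨ ++-μ x x y y ⟩
    (x ++ y) ++ (x ++ y)                    ≡⟨ ⨾-∇ (x ++ y) ⟨
    (x ++ y) ⨾ ∇ (n + m)                    ∎
    where open ≡-Reasoning

  -- Generated cells are pullbacks

  op-injective : ∀ {n} {f} {ts ts' : Vec (Term S n) (ar S f)} → op f ts ≡ op f ts' → ts ≡ ts'
  op-injective refl = refl

  op-head : ∀ {n f g} {ts : Vec (Term S n) (ar S f)} {ts' : Vec (Term S n) (ar S g)} →
            op f ts ≡ op g ts' → f ≡ g
  op-head refl = refl

  Mono : ∀ {n m} → Arr S n m → Set
  Mono {n} h = ∀ {o} (x y : Arr S o n) → x ⨾ h ≡ y ⨾ h → x ≡ y

  transpose : ∀ {o₀ o₁ o₂ o₃} {s : Arr S o₁ o₀} {u : Arr S o₂ o₀} {v : Arr S o₃ o₁} {t : Arr S o₃ o₂} →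
              IsPullback s u v t → IsPullback u s t v
  transpose (eq , univ) = ≡-sym eq , λ v' t' e →
    let h , (p , q) , uniq = univ t' v' (≡-sym e) in h , (q , p) , λ (a , b) → uniq (b , a)

  mono-pullback : ∀ {n m} {h : Arr S n m} → Mono h → IsPullback h h (idA n) (idA n)
  mono-pullback mono = refl , λ v' t' e →
    v' , (⨾-identityʳ v' , trans (⨾-identityʳ v') (≡-sym (mono t' v' e))) ,
    λ {y} (p , _) → trans (≡-sym p) (⨾-identityʳ y)

  identity-pullback : ∀ {n m} (h : Arr S n m) → IsPullback h (idA m) (idA n) h
  identity-pullback h = trans (⨾-identityʳ h) (≡-sym (⨾-identityˡ h)) , λ v' t' e →
    v' , (⨾-identityʳ v' , trans (≡-sym e) (⨾-identityʳ t')) ,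
    λ {y} (p , _) → trans (≡-sym p) (⨾-identityʳ y)

  -- Solving `(e x , y) = (z , z)` leaves exactly the pairs `(x , e x)`, so the apex is the graph of
  -- `e`. Arbitrary `e` is covered because later D-cells are identified by this universal property.
  graph-pullback : ∀ {m n} (e : Arr S m n) →
                   IsPullback (e ⊗ idA n) (∇ n) (∇ m ⨾ (idA m ⊗ e)) e
  graph-pullback {m} {n} e =
    trans (⨾-∇ e) (≡-sym (trans (cong (_⨾ (e ⊗ idA n)) graph)
      (trans (++-⊗ (idA m) e e (idA n)) (cong₂ _++_ (⨾-identityˡ e) (⨾-identityʳ e))))) ,
    λ v' t' eq →
      let x = v' ⨾ fst m n
          y = v' ⨾ snd m n
          p , q = ++-injective t' (x ⨾ e) (trans (≡-sym (⨾-∇ t')) (trans eq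
            (trans (cong (_⨾ (e ⊗ idA n)) (≡-sym (++-η m v'))) (++-⊗ x y e (idA n)))))
      in x ,
         (trans (⨾graph x) (trans (cong (x ++_) (trans (≡-sym p) (trans q (⨾-identityʳ y)))) (++-η m v')) ,
          ≡-sym p) ,
         λ {h} (a , _) → trans (cong (_⨾ fst m n) (trans (≡-sym a) (⨾graph h))) (++-fst h (h ⨾ e))
    where
    graph : ∇ m ⨾ (idA m ⊗ e) ≡ idA m ++ e
    graph = ∇-⊗ (idA m) e
    ⨾graph : ∀ {o} (h : Arr S o m) → h ⨾ (∇ m ⨾ (idA m ⊗ e)) ≡ h ++ (h ⨾ e)
    ⨾graph h = trans (cong (h ⨾_) graph)
              (trans (⨾-++ h (idA m) e) (cong (_++ (h ⨾ e)) (⨾-identityʳ h)))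

  hor-pullback : ∀ {o₀ o₁ o₂ o₃ o₁' o₃'}
          {s₁ : Arr S o₁ o₀} {u₁ : Arr S o₂ o₀} {v₁ : Arr S o₃ o₁} {t₁ : Arr S o₃ o₂}
          {s₂ : Arr S o₁' o₁} {v₂ : Arr S o₃' o₁'} {t₂ : Arr S o₃' o₃} →
          IsPullback s₁ u₁ v₁ t₁ → IsPullback s₂ v₁ v₂ t₂ → IsPullback (s₂ ⨾ s₁) u₁ v₂ (t₂ ⨾ t₁)
  hor-pullback {s₁ = s₁} {u₁} {v₁} {t₁} {s₂} {v₂} {t₂} (eq₁ , univ₁) (eq₂ , univ₂) = eq , univ
    where
    eq : t₂ ⨾ t₁ ⨾ u₁ ≡ v₂ ⨾ (s₂ ⨾ s₁)
    eq = trans (⨾-assoc t₂ t₁ u₁) (trans (cong (t₂ ⨾_) eq₁) (trans (≡-sym (⨾-assoc t₂ v₁ s₁))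
        (trans (cong (_⨾ s₁) eq₂) (⨾-assoc v₂ s₂ s₁))))
    univ : ∀ {o} (v' : Arr S o _) (t' : Arr S o _) → t' ⨾ u₁ ≡ v' ⨾ (s₂ ⨾ s₁) →
           ∃! _≡_ (λ h → (h ⨾ v₂ ≡ v') × (h ⨾ (t₂ ⨾ t₁) ≡ t'))
    univ v' t' e =
      let h₁ , (p₁ , q₁) , uniq₁ = univ₁ (v' ⨾ s₂) t' (trans e (≡-sym (⨾-assoc v' s₂ s₁)))
          h₂ , (p₂ , q₂) , uniq₂ = univ₂ v' h₁ p₁
      in h₂ , (p₂ , trans (≡-sym (⨾-assoc h₂ t₂ t₁)) (trans (cong (_⨾ t₁) q₂) q₁)) ,
         λ {y} (a , b) → uniq₂ (a , ≡-sym (uniq₁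
           ( trans (⨾-assoc y t₂ v₁) (trans (cong (y ⨾_) eq₂) (trans (≡-sym (⨾-assoc y v₂ s₂)) (cong (_⨾ s₂) a)))
           , trans (⨾-assoc y t₂ t₁) b)))

  par-pullback : ∀ {o₀ o₁ o₂ o₃ p₀ p₁ p₂ p₃}
          {s₁ : Arr S o₁ o₀} {u₁ : Arr S o₂ o₀} {v₁ : Arr S o₃ o₁} {t₁ : Arr S o₃ o₂}
          {s₂ : Arr S p₁ p₀} {u₂ : Arr S p₂ p₀} {v₂ : Arr S p₃ p₁} {t₂ : Arr S p₃ p₂} →
          IsPullback s₁ u₁ v₁ t₁ → IsPullback s₂ u₂ v₂ t₂ →
          IsPullback (s₁ ⊗ s₂) (u₁ ⊗ u₂) (v₁ ⊗ v₂) (t₁ ⊗ t₂)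
  par-pullback {o₀} {o₁} {o₂} {o₃} {p₀} {p₁} {p₂} {p₃} {s₁} {u₁} {v₁} {t₁} {s₂} {u₂} {v₂} {t₂}
    (eq₁ , univ₁) (eq₂ , univ₂) =
    trans (⊗-⨾ t₁ u₁ t₂ u₂) (trans (cong₂ _⊗_ eq₁ eq₂) (≡-sym (⊗-⨾ v₁ s₁ v₂ s₂))) , univ
    where
    η-⊗ : ∀ {o n n' m m'} (α : Arr S n m) (β : Arr S n' m') (h : Arr S o (n + n')) →
          h ⨾ (α ⊗ β) ≡ (h ⨾ fst n n' ⨾ α) ++ (h ⨾ snd n n' ⨾ β)
    η-⊗ {n = n} α β h = trans (cong (_⨾ (α ⊗ β)) (≡-sym (++-η n h))) (++-⊗ _ _ α β)
    components : ∀ {o n n' m m'} (α : Arr S n m) (β : Arr S n' m') (h : Arr S o (n + n')) {k : Arr S o (m + m')} →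
          h ⨾ (α ⊗ β) ≡ k →
          (h ⨾ fst n n' ⨾ α ≡ k ⨾ fst m m') × (h ⨾ snd n n' ⨾ β ≡ k ⨾ snd m m')
    components {m = m} α β h {k} e =
      ++-injective _ _ (trans (≡-sym (η-⊗ α β h)) (trans e (≡-sym (++-η m k))))
    univ : ∀ {o} (v' : Arr S o _) (t' : Arr S o _) → t' ⨾ (u₁ ⊗ u₂) ≡ v' ⨾ (s₁ ⊗ s₂) →
           ∃! _≡_ (λ h → (h ⨾ (v₁ ⊗ v₂) ≡ v') × (h ⨾ (t₁ ⊗ t₂) ≡ t'))
    univ v' t' e =
      let c₁ , c₂ = ++-injective (t' ⨾ fst o₂ p₂ ⨾ u₁) (v' ⨾ fst o₁ p₁ ⨾ s₁)
                      (trans (≡-sym (η-⊗ u₁ u₂ t')) (trans e (η-⊗ s₁ s₂ v')))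
          h₁ , (a₁ , b₁) , uniq₁ = univ₁ (v' ⨾ fst o₁ p₁) (t' ⨾ fst o₂ p₂) c₁
          h₂ , (a₂ , b₂) , uniq₂ = univ₂ (v' ⨾ snd o₁ p₁) (t' ⨾ snd o₂ p₂) c₂
      in h₁ ++ h₂ ,
         ( trans (++-⊗ h₁ h₂ v₁ v₂) (trans (cong₂ _++_ a₁ a₂) (++-η o₁ v'))
         , trans (++-⊗ h₁ h₂ t₁ t₂) (trans (cong₂ _++_ b₁ b₂) (++-η o₂ t'))) ,
         λ {y} (a , b) →
           let a₁' , a₂' = components v₁ v₂ y a
               b₁' , b₂' = components t₁ t₂ y b
           in trans (cong₂ _++_ (uniq₁ (a₁' , b₁')) (uniq₂ (a₂' , b₂'))) (++-η o₃ y)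

  D∇-pullback : IsPullback (∇ {S} 1 ⊗ idA 1) (idA 1 ⊗ ∇ 1) (∇ 1) (∇ 1)
  D∇-pullback = refl , univ
    where
    univ : ∀ {o} (v' : Arr S o 2) (t' : Arr S o 2) → t' ⨾ (idA 1 ⊗ ∇ 1) ≡ v' ⨾ (∇ 1 ⊗ idA 1) →
           ∃! _≡_ (λ h → (h ⨾ ∇ 1 ≡ v') × (h ⨾ ∇ 1 ≡ t'))
    -- The equation reads `(c , d , d) = (a , a , b)`, so all four terms coincide.
    univ (a ∷ b ∷ []) (c ∷ d ∷ []) refl = a ∷ [] , (refl , refl) , λ { {x ∷ []} (refl , _) → refl }

  gen⇒pullback : ∀ {o₀ o₁ o₂ o₃} {s : Arr S o₁ o₀} {u : Arr S o₂ o₀} {v : Arr S o₃ o₁} {t : Arr S o₃ o₂} →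
          Gen s u v t → IsPullback s u v t
  gen⇒pullback (R-f f) = mono-pullback {h = sym f} λ x y e →
    trans (≡-sym (⨾-identityʳ x)) (trans (op-injective (cong (λ α → lookup α zero) e)) (⨾-identityʳ y))
  gen⇒pullback (D-f f)   = graph-pullback (sym f)
  gen⇒pullback (D̂-f f)   = transpose {s = sym f ⊗ idA 1} {u = ∇ 1} (graph-pullback (sym f))
  gen⇒pullback R-∇       = mono-pullback λ { (x ∷ []) (y ∷ []) refl → refl }
  gen⇒pullback R-γ       = mono-pullback λ { (x ∷ x' ∷ []) (y ∷ y' ∷ []) refl → refl }
  gen⇒pullback D-∇       = D∇-pullback
  gen⇒pullback (idH h)   = identity-pullback h
  gen⇒pullback (idV w)   = transpose (identity-pullback w)
  gen⇒pullback (hor a b) = hor-pullback (gen⇒pullback a) (gen⇒pullback b)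
  gen⇒pullback (ver a b) = transpose (hor-pullback (transpose (gen⇒pullback a)) (transpose (gen⇒pullback b)))
  gen⇒pullback (par a b) = par-pullback (gen⇒pullback a) (gen⇒pullback b)

  -- Isomorphisms of Th[Σ] are variable permutations

  gen-cast : ∀ {o₀ o₁ o₂ o₃} {s s' : Arr S o₁ o₀} {u u' : Arr S o₂ o₀} {v v' : Arr S o₃ o₁} {t t' : Arr S o₃ o₂} →
         s ≡ s' → u ≡ u' → v ≡ v' → t ≡ t' → Gen s u v t → Gen s' u' v' t'
  gen-cast refl refl refl refl g = g

  record Iso {m n} (h : Arr S m n) : Set where
    field
      inv      : Arr S n m
      inverseʳ : h ⨾ inv ≡ idA m
      inverseˡ : inv ⨾ h ≡ idA n
  open Iso

  iso-sym : ∀ {m n} {h : Arr S m n} (i : Iso h) → Iso (inv i)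
  iso-sym {h = h} i = record { inv = h ; inverseʳ = inverseˡ i ; inverseˡ = inverseʳ i }

  iso-id : ∀ {n} → Iso (idA n)
  iso-id = record { inv = idA _ ; inverseʳ = ⨾-identityˡ _ ; inverseˡ = ⨾-identityˡ _ }

  ⨾-cancel : ∀ {k l m n} (a : Arr S k l) {b : Arr S l m} {c : Arr S m l} (d : Arr S l n) →
             b ⨾ c ≡ idA l → (a ⨾ b) ⨾ (c ⨾ d) ≡ a ⨾ d
  ⨾-cancel a {b} {c} d e =
    trans (⨾-assoc a b (c ⨾ d)) (cong (a ⨾_)
      (trans (≡-sym (⨾-assoc b c d)) (trans (cong (_⨾ d) e) (⨾-identityˡ d))))

  iso-⨾ : ∀ {k m n} {g : Arr S k m} {h : Arr S m n} → Iso g → Iso h → Iso (g ⨾ h)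
  iso-⨾ {g = g} {h} i j = record
    { inv      = inv j ⨾ inv i
    ; inverseʳ = trans (⨾-cancel g (inv i) (inverseʳ j)) (inverseʳ i)
    ; inverseˡ = trans (⨾-cancel (inv j) h (inverseˡ i)) (inverseˡ j)
    }

  iso-⊗ : ∀ {k l m n} {g : Arr S k l} {h : Arr S m n} → Iso g → Iso h → Iso (g ⊗ h)
  iso-⊗ {k} {l} {m} {n} {g} {h} i j = record
    { inv      = inv i ⊗ inv j
    ; inverseʳ = trans (⊗-⨾ g (inv i) h (inv j)) (trans (cong₂ _⊗_ (inverseʳ i) (inverseʳ j)) (id⊗id k m))
    ; inverseˡ = trans (⊗-⨾ (inv i) g (inv j) h) (trans (cong₂ _⊗_ (inverseˡ i) (inverseˡ j)) (id⊗id l n))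
    }

  iso-γ : ∀ n m → Iso (γ n m)
  iso-γ n m = record { inv = γ m n ; inverseʳ = involutive n m ; inverseˡ = involutive m n }
    where
    involutive : ∀ n m → γ n m ⨾ γ m n ≡ idA {S} (n + m)
    involutive n m = trans (++-γ (snd n m) (fst n m)) (fst++snd n m)

  iso-μ : ∀ a b c d → Iso (μ a b c d)
  iso-μ a b c d = record { inv = μ a c b d ; inverseʳ = involutive a b c d ; inverseˡ = involutive a c b d }
    where
    involutive : ∀ a b c d → μ a b c d ⨾ μ a c b d ≡ idA ((a + b) + (c + d))
    involutive a b c d = ++-ext₄ {a} {b} {c} {d} λ x y z w →
      trans (≡-sym (⨾-assoc ((x ++ y) ++ (z ++ w)) (μ a b c d) (μ a c b d)))
      (trans (cong (_⨾ μ a c b d) (++-μ x y z w))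
      (trans (++-μ x z y w) (≡-sym (⨾-identityʳ ((x ++ y) ++ (z ++ w))))))

  -- The shape of `R-f`, `R-∇` and `R-γ`. For invertible `h` this one cell, pasted with identity
  -- cells, yields a square over any cospan having `h` as a leg.
  MonoCell : ∀ {n m} → Arr S n m → Set
  MonoCell {n} h = Gen h h (idA n) (idA n)

  monoCell-⨾ : ∀ {k m n} {g : Arr S k m} {h : Arr S m n} → MonoCell g → MonoCell h → MonoCell (g ⨾ h)
  monoCell-⨾ {g = g} cg ch =
    gen-cast refl refl (⨾-identityˡ _) refl
      (ver (gen-cast refl refl refl (⨾-identityʳ g) (hor ch (idH g))) cg)

  monoCell-⊗ : ∀ {k l m n} {g : Arr S k l} {h : Arr S m n} → MonoCell g → MonoCell h → MonoCell (g ⊗ h)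
  monoCell-⊗ {k} {m = m} cg ch = gen-cast refl refl (id⊗id k m) (id⊗id k m) (par cg ch)

  front : ∀ {n} → Fin (suc n) → Arr S (suc n) (suc n)
  front i = var i ∷ ren (punchIn i)

  front-⊗ : ∀ {n m k} (i : Fin (suc n)) (α : Arr S 1 k) (β : Arr S n m) →
            front i ⨾ (α ⊗ β) ≡ ((var i ∷ []) ⨾ α) ++ (ren (punchIn i) ⨾ β)
  front-⊗ i α β = ++-⊗ (var i ∷ []) (ren (punchIn i)) α β

  -- The cycle for `suc i` is the cycle for `i` on the later variables followed by one swap of the
  -- first two positions, so every `front i` is built from `γ 1 1`.
  front-suc : ∀ {n} (i : Fin (suc n)) → (idA 1 ⊗ front i) ⨾ (γ 1 1 ⊗ idA n) ≡ front (suc i)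
  front-suc {n} i = begin
    (var zero ∷ lookup (ren suc) i ∷ rest) ⨾ (γ 1 1 ⊗ idA n)
      ≡⟨ ++-⊗ (var zero ∷ lookup (ren suc) i ∷ []) rest (γ 1 1) (idA n) ⟩
    lookup (ren suc) i ∷ var zero ∷ (rest ⨾ idA n)
      ≡⟨ cong₂ (λ t ts → t ∷ var zero ∷ ts) (lookup∘tabulate (var ∘ suc) i)
           (trans (⨾-identityʳ rest) (ren-⨾ suc (punchIn i))) ⟩
    front (suc i) ∎
    where
    open ≡-Reasoning
    rest : Arr S (suc (suc n)) n
    rest = ren suc ⨾ ren (punchIn i)

  iso-front : ∀ {n} (i : Fin (suc n)) → Iso (front i)
  iso-front zero            = iso-id
  iso-front {suc n} (suc i) =
    subst Iso (front-suc i) (iso-⨾ (iso-⊗ (iso-id {1}) (iso-front i)) (iso-⊗ (iso-γ 1 1) (iso-id {n})))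

  monoCell-front : ∀ {n} (i : Fin (suc n)) → MonoCell (front i)
  monoCell-front zero            = idH (idA _)
  monoCell-front {suc n} (suc i) =
    subst MonoCell (front-suc i)
      (monoCell-⨾ (monoCell-⊗ (idH (idA 1)) (monoCell-front i)) (monoCell-⊗ R-γ (idH (idA n))))

  -- Induction on the length: `front` fetches the image of `zero`, and `remove zero p` permutes what
  -- is left.
  monoCell-ren : ∀ {n m} (p : Permutation n m) → MonoCell (ren (p ⟨$⟩ʳ_))
  monoCell-ren {zero}  {zero}  p = idH []
  monoCell-ren {zero}  {suc m} p = case p ⟨$⟩ˡ zero of λ ()
  monoCell-ren {suc n} {zero}  p = case p ⟨$⟩ʳ zero of λ ()
  monoCell-ren {suc n} {suc m} p =
    subst MonoCell factor
      (monoCell-⨾ (monoCell-front (p ⟨$⟩ʳ zero)) (monoCell-⊗ (idH (idA 1)) (monoCell-ren (remove zero p))))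
    where
    factor : front (p ⟨$⟩ʳ zero) ⨾ (idA 1 ⊗ ren (remove zero p ⟨$⟩ʳ_)) ≡ ren (p ⟨$⟩ʳ_)
    factor = trans (front-⊗ (p ⟨$⟩ʳ zero) (idA 1) _)
      (cong (_ ∷_) (trans (ren-⨾ (punchIn (p ⟨$⟩ʳ zero)) (remove zero p ⟨$⟩ʳ_))
        (tabulate-cong (λ j → cong var (≡-sym (punchIn-permute p zero j))))))

  sub-var⁻¹ : ∀ {n m} (σ : Arr S m n) t {i} → sub σ t ≡ var i → ∃[ j ] t ≡ var j
  sub-var⁻¹ σ (var j) _ = j , refl

  var-injective : ∀ {n} {i j : Fin n} → var {S} i ≡ var j → i ≡ j
  var-injective refl = refl

  -- Substitution never turns an operation term into a variable, so a component of `h` that `k`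
  -- sends to a variable is itself one.
  section-vars : ∀ {m n} {h : Arr S m n} {k : Arr S n m} → k ⨾ h ≡ idA n →
                 ∀ i → ∃[ j ] lookup h i ≡ var j × lookup k j ≡ var i
  section-vars {h = h} {k} e i =
    let e' = trans (≡-sym (lookup-⨾ k h i)) (trans (cong (λ α → lookup α i) e) (lookup∘tabulate var i))
        j , p = sub-var⁻¹ k (lookup h i) e'
    in j , p , trans (cong (sub k) (≡-sym p)) e'

  monoCell-iso : ∀ {m n} {h : Arr S m n} → Iso h → MonoCell h
  monoCell-iso {m} {n} {h} i =
    -- `P` writes `h` as the renaming by `p`, and `Q` writes its inverse as the renaming by `q`;
    -- their last components make `p` and `q` mutually inverse.
    subst MonoCell (trans (tabulate-cong (λ x → ≡-sym (proj₁ (proj₂ (P x))))) (tabulate∘lookup h))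
      (monoCell-ren (permutation p q
        (λ y → var-injective (trans (≡-sym (proj₁ (proj₂ (P (q y))))) (proj₂ (proj₂ (Q y)))))
        (λ x → var-injective (trans (≡-sym (proj₁ (proj₂ (Q (p x))))) (proj₂ (proj₂ (P x)))))))
    where
    P = section-vars (inverseˡ i)
    Q = section-vars (inverseʳ i)
    p : Fin n → Fin m
    p x = proj₁ (P x)
    q : Fin m → Fin n
    q y = proj₁ (Q y)

  -- Generated squares over a cospan

  -- Only the cospan is fixed: `pullback-generated` later trades the apex and projections found here
  -- for those of any given pullback.
  Sq : ∀ {o₀ o₁ o₂} → Arr S o₁ o₀ → Arr S o₂ o₀ → Set
  Sq {o₁ = o₁} {o₂} s u = ∃[ o₃ ] ∃[ v ] ∃[ t ] Gen {o₁ = o₁} {o₂} {o₃} s u v t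

  sq : ∀ {o₀ o₁ o₂ o₃} {s : Arr S o₁ o₀} {u : Arr S o₂ o₀} {v : Arr S o₃ o₁} {t : Arr S o₃ o₂} →
       Gen s u v t → Sq s u
  sq g = _ , _ , _ , g

  sq-cast : ∀ {o₀ o₁ o₂} {s s' : Arr S o₁ o₀} {u u' : Arr S o₂ o₀} → s ≡ s' → u ≡ u' → Sq s u → Sq s' u'
  sq-cast refl refl x = x

  sq-ver : ∀ {o₀ o₁ o₂ o₃ o₂'} {s : Arr S o₁ o₀} {u : Arr S o₂ o₀} {v : Arr S o₃ o₁} {t : Arr S o₃ o₂}
           {u' : Arr S o₂' o₂} → Gen s u v t → Sq t u' → Sq s (u' ⨾ u)
  sq-ver g (_ , _ , _ , g') = sq (ver g g')

  sq-hor : ∀ {o₀ o₁ o₂ o₃ o₁'} {s : Arr S o₁ o₀} {u : Arr S o₂ o₀} {v : Arr S o₃ o₁} {t : Arr S o₃ o₂}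
           {s' : Arr S o₁' o₁} → Gen s u v t → Sq s' v → Sq (s' ⨾ s) u
  sq-hor g (_ , _ , _ , g') = sq (hor g g')

  -- The mono cell of `π` pasted with the identity cell on `inv i` is `⟨π, id, π⁻¹, id⟩`, to which
  -- `idV u` can be attached.
  sq-isoˡ : ∀ {o₀ o₁ o₂} {π : Arr S o₁ o₀} → Iso π → (u : Arr S o₂ o₀) → Sq π u
  sq-isoˡ i u = sq-cast refl (⨾-identityʳ u)
    (sq (ver (gen-cast refl (inverseˡ i) refl refl (ver (monoCell-iso i) (idV (inv i)))) (idV u)))

  sq-isoʳ : ∀ {o₀ o₁ o₂} {π : Arr S o₂ o₀} (s : Arr S o₁ o₀) → Iso π → Sq s π
  sq-isoʳ s i = sq-cast (⨾-identityʳ s) refl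
    (sq (hor (gen-cast (inverseˡ i) refl refl refl (hor (monoCell-iso i) (idH (inv i)))) (idH s)))

  sq-post : ∀ {o₀ o₁ o₂ o₀'} {s : Arr S o₁ o₀} {u : Arr S o₂ o₀} {π : Arr S o₀ o₀'} →
            Iso π → Sq s u → Sq (s ⨾ π) (u ⨾ π)
  sq-post {s = s} i x = sq-ver (gen-cast refl refl refl (⨾-identityʳ s) (hor (monoCell-iso i) (idH s))) x

  sq-preˡ : ∀ {o₀ o₁ o₂ o₁'} {s : Arr S o₁ o₀} {u : Arr S o₂ o₀} {π : Arr S o₁' o₁} →
            Iso π → Sq s u → Sq (π ⨾ s) u
  sq-preˡ i (_ , v , _ , g) = sq-hor g (sq-isoˡ i v)

  sq-preʳ : ∀ {o₀ o₁ o₂ o₂'} {s : Arr S o₁ o₀} {u : Arr S o₂ o₀} {π : Arr S o₂' o₂} →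
            Iso π → Sq s u → Sq s (π ⨾ u)
  sq-preʳ i (_ , _ , t , g) = sq-ver g (sq-isoʳ t i)

  -- The apex changes by pasting with `⟨id, id, h, h⟩`, here `shift`. It comes from
  -- `⟨id, h⁻¹, id, h⟩`, which the mono cell of the inverse provides.
  gen-reindex : ∀ {o₀ o₁ o₂ o₃ o} {s : Arr S o₁ o₀} {u : Arr S o₂ o₀} {v : Arr S o₃ o₁} {t : Arr S o₃ o₂}
                {h : Arr S o o₃} → Iso h → Gen s u v t → Gen s u (h ⨾ v) (h ⨾ t)
  gen-reindex {u = u} {t = t} {h} i g =
    gen-cast refl (⨾-identityˡ u) refl refl
      (ver g (gen-cast (⨾-identityˡ t) refl refl refl (hor (idH t) shift)))
    where
    unshift : Gen (idA _) (inv i) (idA _) h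
    unshift = gen-cast (inverseʳ i) refl refl (⨾-identityʳ h) (hor (monoCell-iso (iso-sym i)) (idH h))
    shift : Gen (idA _) (idA _) h h
    shift = gen-cast refl (inverseˡ i) (⨾-identityˡ h) refl (ver (idV h) unshift)

  -- By soundness the cell found is a pullback as well, so the mediating arrows between the two
  -- apexes are mutually inverse and `gen-reindex` applies.
  pullback-generated : ∀ {o₀ o₁ o₂ o₃} {s : Arr S o₁ o₀} {u : Arr S o₂ o₀} {v : Arr S o₃ o₁} {t : Arr S o₃ o₂} →
                       Sq s u → IsPullback s u v t → Gen s u v t
  pullback-generated {s = s} {u} {v} {t} (_ , v' , t' , g) (eq , univ) =
    let eq' , univ' = gen⇒pullback g
        h , (hv , ht) , _ = univ' v t eq
        k , (kv , kt) , _ = univ v' t' eq'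
    in gen-cast refl refl hv ht (gen-reindex (record
         { inv      = k
         ; inverseʳ = endo-id eq univ (retract hv kv) (retract ht kt)
         ; inverseˡ = endo-id eq' univ' (retract kv hv) (retract kt ht)
         }) g)
    where
    retract : ∀ {a b c} {x : Arr S a c} {y : Arr S b c} {h : Arr S a b} {k : Arr S b a} →
              h ⨾ y ≡ x → k ⨾ x ≡ y → (h ⨾ k) ⨾ x ≡ x
    retract {x = x} {h = h} {k} p q = trans (⨾-assoc h k x) (trans (cong (h ⨾_) q) p)
    endo-id : ∀ {o} {v : Arr S o _} {t : Arr S o _} (eq : t ⨾ u ≡ v ⨾ s) →
              (∀ {o'} (v' : Arr S o' _) (t' : Arr S o' _) → t' ⨾ u ≡ v' ⨾ s →
                 ∃! _≡_ (λ (h : Arr S o' o) → (h ⨾ v ≡ v') × (h ⨾ t ≡ t'))) →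
              {g : Arr S o o} → g ⨾ v ≡ v → g ⨾ t ≡ t → g ≡ idA o
    endo-id {v = v} {t} eq univ p q =
      let _ , _ , uniq = univ v t eq
      in trans (≡-sym (uniq (p , q))) (uniq (⨾-identityˡ v , ⨾-identityˡ t))

  -- Induction along the decomposition of arrows into generators

  -- The fields follow the presentation of the theory by symmetries, discarding, copying and the
  -- symbols. The instances are `D-sq` and `Good`.
  record Closed (P : ∀ {n m} → Arr S n m → Set) : Set where
    field
      iso     : ∀ {n m} {h : Arr S n m} → Iso h → P h
      comp    : ∀ {n m k} {α : Arr S n m} {β : Arr S m k} → P α → P β → P (α ⨾ β)
      tensor  : ∀ {n m n' m'} {α : Arr S n m} {β : Arr S n' m'} → P α → P β → P (α ⊗ β)
      discard : P {1} {0} []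
      dup     : P (∇ 1)
      symb    : ∀ f → P (sym f)

  module _ {P : ∀ {n m} → Arr S n m → Set} (closed : Closed P) where
    open Closed closed

    discard-all : ∀ n → P {n} {0} []
    discard-all zero    = iso (iso-id {0})
    discard-all (suc n) = tensor discard (discard-all n)

    dup-all : ∀ n → P (∇ n)
    dup-all zero    = iso (iso-id {0})
    dup-all (suc n) = subst P (∇-+ 1 n) (comp (tensor dup (dup-all n)) (iso (iso-μ 1 1 n n)))

    mutual
      -- A variable is fetched by `front` and the others are discarded; an operation term is its
      -- argument tuple followed by the symbol; a nonempty tuple copies all its variables, one copy
      -- for the head and one for the tail.
      term-induction : ∀ {n} (t : Term S n) → P (t ∷ [])
      term-induction {suc n} (var i) =
        subst P (front-⊗ i (idA 1) []) (comp (iso (iso-front i)) (tensor (iso (iso-id {1})) (discard-all n)))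
      term-induction (op f ts) =
        subst P (cong (λ α → op f α ∷ []) (⨾-identityʳ ts)) (comp (arr-induction ts) (symb f))

      arr-induction : ∀ {n m} (α : Arr S n m) → P α
      arr-induction []      = discard-all _
      arr-induction (t ∷ α) =
        subst P (∇-⊗ (t ∷ []) α) (comp (dup-all _) (tensor (term-induction t) (arr-induction α)))

  -- D-cells for arbitrary arrows

  -- The basis lists no transpose of `D-∇`, but reversing the variables of both legs and of the
  -- target exchanges `∇ 1 ⊗ idA 1` with `idA 1 ⊗ ∇ 1`.
  D̂-∇ : Gen (idA 1 ⊗ ∇ {S} 1) (∇ 1 ⊗ idA 1) (∇ 1) (∇ 1)
  D̂-∇ = pullback-generated
    (sq-preˡ (iso-γ 1 1) (sq-preʳ (iso-γ 1 1) (sq-post reverse (sq D-∇))))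
    (transpose D∇-pullback)
    where
    r : Arr S 3 3
    r = var (suc (suc zero)) ∷ var (suc zero) ∷ var zero ∷ []
    reverse : Iso r
    reverse = record { inv = r ; inverseʳ = refl ; inverseˡ = refl }

  -- The cospan of `D-f` with an arbitrary arrow in place of the symbol.
  D-sq : ∀ {m n} → Arr S m n → Set
  D-sq {n = n} e = Sq (e ⊗ idA n) (∇ n)

  -- (a,a,b,c) = (x,y,x,y) is, up to symmetries, (b,a,a,c) = (x,x,y,y): D̂-∇ solves
  -- (b,a,a,c) = (p,p,q,r), whose solution forces p = q, and D-∇ then solves (p,p,r) = (x,y,y).
  D-sq-∇ : D-sq (∇ 1)
  D-sq-∇ = sq-preˡ (iso-⊗ (iso-γ 1 1) (iso-id {1}))
    (sq-post rotate (sq (ver (par D̂-∇ (idH (idA 1))) D-∇)))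
    where
    x₀ x₁ x₂ x₃ : Term S 4
    x₀ = var zero
    x₁ = var (suc zero)
    x₂ = var (suc (suc zero))
    x₃ = var (suc (suc (suc zero)))
    rotate : Iso (x₁ ∷ x₂ ∷ x₀ ∷ x₃ ∷ [])
    rotate = record { inv = x₂ ∷ x₀ ∷ x₁ ∷ x₃ ∷ [] ; inverseʳ = refl ; inverseˡ = refl }

  -- Pulling `∇ n` back along `β ⊗ idA n` gives the graph `∇ m ⨾ (idA m ⊗ β)`; `graph-pullback` pins
  -- this leg down. Along `α ⊗ idA n`, the factor `idA m ⊗ β` slides past `α`, which leaves `∇ m`
  -- against `α ⊗ idA m`.
  D-sq-⨾ : ∀ {l m n} {α : Arr S l m} {β : Arr S m n} → D-sq α → D-sq β → D-sq (α ⨾ β)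
  D-sq-⨾ {m = m} {n} {α} {β} dα dβ =
    sq-cast (trans (⊗-⨾ α β (idA n) (idA n)) (cong ((α ⨾ β) ⊗_) (⨾-identityˡ (idA n)))) refl
      (sq-hor (pullback-generated dβ (graph-pullback β)) (sq-ver (par (idH α) (idV β)) dα))

  D-sq-⊗ : ∀ {m n m' n'} {α : Arr S m n} {β : Arr S m' n'} → D-sq α → D-sq β → D-sq (α ⊗ β)
  D-sq-⊗ {m} {n} {m'} {n'} {α} {β} (_ , _ , _ , gα) (_ , _ , _ , gβ) =
    sq-cast interchange (∇-+ n n')
      (sq-preˡ (iso-μ m m' n n') (sq-post (iso-μ n n n' n') (sq (par gα gβ))))
    where
    open ≡-Reasoning
    A = α ⊗ idA n
    B = β ⊗ idA n'
    M = μ m m' n n'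
    N = μ n n n' n'
    interchange : M ⨾ ((A ⊗ B) ⨾ N) ≡ (α ⊗ β) ⊗ idA (n + n')
    interchange = ++-ext₄ {m} {m'} {n} {n'} λ x y z w → begin
      ((x ++ y) ++ (z ++ w)) ⨾ (M ⨾ ((A ⊗ B) ⨾ N))
        ≡⟨ ⨾-assoc ((x ++ y) ++ (z ++ w)) M ((A ⊗ B) ⨾ N) ⟨
      (((x ++ y) ++ (z ++ w)) ⨾ M) ⨾ ((A ⊗ B) ⨾ N)
        ≡⟨ cong (_⨾ ((A ⊗ B) ⨾ N)) (++-μ x y z w) ⟩
      ((x ++ z) ++ (y ++ w)) ⨾ ((A ⊗ B) ⨾ N)
        ≡⟨ ⨾-assoc ((x ++ z) ++ (y ++ w)) (A ⊗ B) N ⟨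
      (((x ++ z) ++ (y ++ w)) ⨾ (A ⊗ B)) ⨾ N
        ≡⟨ cong (_⨾ N) (++-⊗ (x ++ z) (y ++ w) A B) ⟩
      (((x ++ z) ⨾ A) ++ ((y ++ w) ⨾ B)) ⨾ N
        ≡⟨ cong (_⨾ N) (cong₂ _++_ (++-⊗ x z α (idA n)) (++-⊗ y w β (idA n'))) ⟩
      (((x ⨾ α) ++ (z ⨾ idA n)) ++ ((y ⨾ β) ++ (w ⨾ idA n'))) ⨾ N
        ≡⟨ ++-μ (x ⨾ α) (z ⨾ idA n) (y ⨾ β) (w ⨾ idA n') ⟩
      ((x ⨾ α) ++ (y ⨾ β)) ++ ((z ⨾ idA n) ++ (w ⨾ idA n'))
        ≡⟨ cong₂ _++_ (≡-sym (++-⊗ x y α β))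
             (trans (cong₂ _++_ (⨾-identityʳ z) (⨾-identityʳ w)) (≡-sym (⨾-identityʳ (z ++ w)))) ⟩
      ((x ++ y) ⨾ (α ⊗ β)) ++ ((z ++ w) ⨾ idA (n + n'))
        ≡⟨ ++-⊗ (x ++ y) (z ++ w) (α ⊗ β) (idA (n + n')) ⟨
      ((x ++ y) ++ (z ++ w)) ⨾ ((α ⊗ β) ⊗ idA (n + n')) ∎

  D-sq-closed : Closed D-sq
  D-sq-closed = record
    { iso     = λ i → sq-isoˡ (iso-⊗ i iso-id) _
    ; comp    = D-sq-⨾
    ; tensor  = D-sq-⊗
    -- `∇ 0` is the identity on `0`, hence an invertible leg.
    ; discard = sq-isoʳ _ (iso-id {0})
    ; dup     = D-sq-∇
    ; symb    = λ f → sq (D-f f)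
    }

  -- Pulling back along a solvable cospan

  -- Some cospans, such as two clashing symbols, admit no commutative square, so a solution
  -- `(v' , t')` is demanded. The leg `v'` is a parameter so that unification can recurse on it.
  GoodAt : ∀ {o o₀ o₁} → Arr S o₁ o₀ → Arr S o o₁ → Set
  GoodAt {o} {o₀} s v' = ∀ {o₂} (u : Arr S o₂ o₀) (t' : Arr S o o₂) → t' ⨾ u ≡ v' ⨾ s → Sq s u

  goodAt-iso : ∀ {o o₀ o₁} {π : Arr S o₁ o₀} {v' : Arr S o o₁} → Iso π → GoodAt π v'
  goodAt-iso i u _ _ = sq-isoˡ i u

  -- The given solution factors through the first generated square, which is a pullback by
  -- soundness; the mediating `h` is the solution needed for the second square.
  goodAt-⨾ : ∀ {o o₀ o₁ o₁'} {s : Arr S o₁ o₀} {s' : Arr S o₁' o₁} {v' : Arr S o o₁'} →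
             GoodAt s' v' → GoodAt s (v' ⨾ s') → GoodAt (s' ⨾ s) v'
  goodAt-⨾ {s = s} {s'} {v'} good' good u t' e =
    let e' = trans e (≡-sym (⨾-assoc v' s' s))
        _ , v , _ , g = good u t' e'
        h , (p , _) , _ = proj₂ (gen⇒pullback g) (v' ⨾ s') t' e'
    in sq-hor g (good' v h p)

  -- Split `u` as `∇ o₂ ⨾ (u₁ ⊗ u₂)`. The square for `s` and `u₁` beside `u₂` has far side `t ⊗ id`,
  -- and the remaining `∇ o₂` is pulled back by the D-cell of `t`, an arrow not known in advance.
  goodAt-⊗id : ∀ {o n m k} {s : Arr S n m} {x : Arr S o n} {y : Arr S o k} →
               GoodAt s x → GoodAt (s ⊗ idA k) (x ++ y)
  goodAt-⊗id {n = n} {m} {k} {s} {x} {y} good u t' e =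
    let u₁ = u ⨾ fst m k
        u₂ = u ⨾ snd m k
        u-η = ++-η m u
        p , _ = ++-injective (t' ⨾ u₁) (x ⨾ s)
          (trans (≡-sym (⨾-++ t' u₁ u₂)) (trans (cong (t' ⨾_) u-η) (trans e (++-⊗ x y s (idA k)))))
        _ , _ , t , g = good u₁ t' p
    in sq-cast refl (trans (∇-⊗ u₁ u₂) u-η)
         (sq-ver (par g (idV u₂)) (arr-induction D-sq-closed t))

  goodAt-id⊗ : ∀ {o n m k} {s : Arr S n m} {x : Arr S o k} {y : Arr S o n} →
               GoodAt s y → GoodAt (idA k ⊗ s) (x ++ y)
  goodAt-id⊗ {n = n} {m} {k} {s} {x} {y} good =
    subst (λ α → GoodAt α (x ++ y)) conjugate
      (goodAt-⨾ (goodAt-iso (iso-γ k n))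
        (subst (GoodAt _) (≡-sym (++-γ x y)) (goodAt-⨾ (goodAt-⊗id good) (goodAt-iso (iso-γ m k)))))
    where
    conjugate : γ k n ⨾ ((s ⊗ idA k) ⨾ γ m k) ≡ idA k ⊗ s
    conjugate = trans (≡-sym (⨾-assoc (γ k n) (s ⊗ idA k) (γ m k)))
      (trans (cong (_⨾ γ m k) (++-⊗ (snd k n) (fst k n) s (idA k)))
             (++-γ (snd k n ⨾ s) (fst k n ⨾ idA k)))

  goodAt-⊗ : ∀ {o n m n' m'} {s : Arr S n m} {s' : Arr S n' m'} {x : Arr S o n} {y : Arr S o n'} →
             GoodAt s x → GoodAt s' y → GoodAt (s ⊗ s') (x ++ y)
  goodAt-⊗ {n' = n'} {s = s} {s'} {x} {y} good good' =
    subst (λ α → GoodAt α (x ++ y)) (⊗-split s s')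
      (goodAt-⨾ (goodAt-⊗id good)
        (subst (GoodAt _) (≡-sym (trans (++-⊗ x y s (idA n')) (cong ((x ⨾ s) ++_) (⨾-identityʳ y))))
          (goodAt-id⊗ good')))

  -- For an operation term, solvability forces its head to be `f`, so `R-f` applies. A variable is a
  -- projection: `f` is plugged in for it, while the other variables are carried along by an
  -- identity cell.
  goodAt-sym : ∀ {o} f {v' : Arr S o (ar S f)} → GoodAt (sym f) v'
  goodAt-sym f (op g ts ∷ []) t' e with op-head (cong (λ α → lookup α zero) e)
  ... | refl = sq-cast refl (cong (λ α → op f α ∷ []) (⨾-identityʳ ts)) (sq (ver (R-f f) (idV ts)))
  goodAt-sym f {o₂ = suc n} (var i ∷ []) t' e =
    sq-cast (⨾-identityˡ (sym f)) eq
      (sq-preʳ (iso-front i) (sq-preʳ (iso-γ 1 n) (sq (par (idV []) (idH (sym f))))))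
    where
    eq : front i ⨾ (γ 1 n ⨾ ([] ⊗ idA 1)) ≡ var i ∷ []
    eq = trans (≡-sym (⨾-assoc (front i) (γ 1 n) ([] ⊗ idA 1)))
        (trans (cong (_⨾ ([] ⊗ idA 1)) (++-γ (var i ∷ []) (ren (punchIn i))))
               (++-⊗ (ren (punchIn i)) (var i ∷ []) [] (idA 1)))

  -- Unification of two terms

  -- `punchIn i j` ranges over the variables other than `i`. Once both are moved to the front the
  -- pair is a projection, and the square is `∇ 1` beside the untouched rest.
  sq-∇-vars : ∀ {n} (i : Fin (suc n)) (j : Fin n) → Sq (∇ 1) (var i ∷ var (punchIn i j) ∷ [])
  sq-∇-vars {suc n} i j =
    sq-cast refl eq
      (sq-preʳ (iso-front i) (sq-preʳ (iso-⊗ (iso-id {1}) (iso-front j))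
        (sq-preʳ (iso-γ 2 n) (sq (par (idV []) (idH (∇ 1)))))))
    where
    open ≡-Reasoning
    π = idA 1 ⊗ front j
    ρ : Arr S (2 + n) 2
    ρ = γ 2 n ⨾ ([] ⊗ idA 2)
    pair : Arr S (2 + n) 2
    pair = var i ∷ var (punchIn i j) ∷ []
    rest : Arr S (2 + n) n
    rest = ren (punchIn i) ⨾ ren (punchIn j)
    eq : front i ⨾ (π ⨾ ρ) ≡ pair
    eq = begin
      front i ⨾ (π ⨾ ρ)                          ≡⟨ ⨾-assoc (front i) π ρ ⟨
      (front i ⨾ π) ⨾ ρ                          ≡⟨ cong (_⨾ ρ) (front-⊗ i (idA 1) (front j)) ⟩
      (var i ∷ lookup (ren (punchIn i)) j ∷ rest) ⨾ ρ
        ≡⟨ cong (λ t → (var i ∷ t ∷ rest) ⨾ ρ) (lookup∘tabulate (var ∘ punchIn i) j) ⟩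
      (pair ++ rest) ⨾ ρ                         ≡⟨ ⨾-assoc (pair ++ rest) (γ 2 n) ([] ⊗ idA 2) ⟨
      ((pair ++ rest) ⨾ γ 2 n) ⨾ ([] ⊗ idA 2)    ≡⟨ cong (_⨾ ([] ⊗ idA 2)) (++-γ pair rest) ⟩
      (rest ++ pair) ⨾ ([] ⊗ idA 2)              ≡⟨ ++-⊗ rest pair [] (idA 2) ⟩
      pair                                       ∎

  -- D̂-f replaces the equation f(ts) = b by f(ys) = b and ys = ts for fresh ys.
  sq-∇-op : ∀ {o n} f (cs : Vec (Term S o) (ar S f)) → GoodAt (∇ (ar S f)) cs →
            (ts : Vec (Term S n) (ar S f)) (b : Term S n) (τ : Arr S o n) →
            τ ⨾ ts ≡ cs → sub τ b ≡ op f cs → Sq (∇ 1) (op f ts ∷ b ∷ [])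
  sq-∇-op f cs good ts b τ p q =
    sq-cast refl factor (sq-ver (D̂-f f)
      -- The fresh `ys` are instantiated by `cs`. First `f(ys) = b` is solved on one copy of `ys`,
      -- then `good` identifies the two copies.
      (goodAt-⨾ good (subst (GoodAt _) (≡-sym (⨾-∇ cs)) (goodAt-id⊗ {x = cs} {y = cs} (goodAt-sym f)))
        (ts ++ (b ∷ [])) τ square))
    where
    open ≡-Reasoning
    k = ar S f
    factor : (ts ++ (b ∷ [])) ⨾ (sym f ⊗ idA 1) ≡ op f ts ∷ b ∷ []
    factor = trans (++-⊗ ts (b ∷ []) (sym f) (idA 1))
                   (cong (λ α → op f α ∷ b ∷ []) (⨾-identityʳ ts))
    square : τ ⨾ (ts ++ (b ∷ [])) ≡ cs ⨾ (∇ k ⨾ (idA k ⊗ sym f))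
    square = begin
      τ ⨾ (ts ++ (b ∷ []))              ≡⟨ ⨾-++ τ ts (b ∷ []) ⟩
      (τ ⨾ ts) ++ (sub τ b ∷ [])        ≡⟨ cong₂ (λ α c → α ++ (c ∷ [])) p q ⟩
      cs ++ (op f cs ∷ [])              ≡⟨ cong₂ (λ α β → α ++ (op f β ∷ [])) (⨾-identityʳ cs) (⨾-identityʳ cs) ⟨
      (cs ⨾ idA k) ++ (cs ⨾ sym f)      ≡⟨ ++-⊗ cs cs (idA k) (sym f) ⟨
      (cs ++ cs) ⨾ (idA k ⊗ sym f)      ≡⟨ cong (_⨾ (idA k ⊗ sym f)) (⨾-∇ cs) ⟨
      (cs ⨾ ∇ k) ⨾ (idA k ⊗ sym f)      ≡⟨ ⨾-assoc cs (∇ k) (idA k ⊗ sym f) ⟩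
      cs ⨾ (∇ k ⨾ (idA k ⊗ sym f))      ∎

  -- Recursion on the common instance c makes both termination and the occurs check automatic.
  mutual
    unify : ∀ {o n} (c : Term S o) (a b : Term S n) (τ : Arr S o n) →
            sub τ a ≡ c → sub τ b ≡ c → Sq (∇ 1) (a ∷ b ∷ [])
    unify {n = suc n} c (var i) (var j) τ p q with i ≟ j
    -- A repeated variable is that variable followed by `∇ 1`, so `R-∇` absorbs the duplicator.
    ... | yes refl = sq (ver R-∇ (idV (var i ∷ [])))
    ... | no i≢j   = subst (λ k → Sq (∇ 1) (var i ∷ var k ∷ [])) (punchIn-punchOut i≢j)
                       (sq-∇-vars i (punchOut i≢j))
    unify (op f cs) (op f ts) b τ refl q = sq-∇-op f cs (unify-all cs) ts b τ refl q
    unify (op f cs) a (op f ts) τ p refl =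
      sq-post (iso-γ 1 1) (sq-∇-op f cs (unify-all cs) ts a τ refl p)

    unify-all : ∀ {o k} (cs : Arr S o k) → GoodAt (∇ k) cs
    unify-all []                    = goodAt-iso {v' = []} (iso-id {0})
    unify-all {k = suc k} (c ∷ cs) =
      subst (λ α → GoodAt α (c ∷ cs)) (∇-+ 1 k)
        (goodAt-⨾ (goodAt-⊗ {x = c ∷ []} {y = cs} (goodAt-∇ c) (unify-all cs)) (goodAt-iso (iso-μ 1 1 k k)))

    goodAt-∇ : ∀ {o} (c : Term S o) → GoodAt (∇ 1) (c ∷ [])
    goodAt-∇ c (a ∷ b ∷ []) τ e =
      unify c a b τ (cong (λ α → lookup α zero) e) (cong (λ α → lookup α (suc zero)) e)

  -- All pullbacks are generated

  Good : ∀ {n m} → Arr S n m → Set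
  Good {n} s = ∀ {o} (v' : Arr S o n) → GoodAt s v'

  good-closed : Closed Good
  good-closed = record
    { iso     = λ i _ → goodAt-iso i
    ; comp    = λ p q v' → goodAt-⨾ (p v') (q (v' ⨾ _))
    ; tensor  = λ {n} {n' = n'} p q v' → subst (GoodAt _) (++-η n v')
                  (goodAt-⊗ {x = v' ⨾ fst n n'} {y = v' ⨾ snd n n'} (p _) (q _))
    -- Over the object `0` a pullback is a product: the two variable blocks side by side.
    ; discard = λ { _ [] _ _ → sq (par (idH []) (idV [])) }
    ; dup     = λ { (c ∷ []) → goodAt-∇ c }
    ; symb    = λ f _ → goodAt-sym f
    }

theorem3p10 : (S : Signature) {o₀ o₁ o₂ o₃ : ℕ}
    (s : Arr S o₁ o₀) (u : Arr S o₂ o₀) (v : Arr S o₃ o₁) (t : Arr S o₃ o₂) →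
    t ⨾ u ≡ v ⨾ s →
    Gen s u v t ⇔ IsPullback s u v t
theorem3p10 S s u v t e = mk⇔ gen⇒pullback λ pb →
  -- The given square is itself the solution that `Good` asks for.
  pullback-generated (arr-induction good-closed s v u t e) pb
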